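{- $\mathrm{add}(\mathcal{M})=\min\{\mathrm{add}(\mathcal{H}_F): F\in\omega^\omega \text{ increasing}\}$ and $\mathrm{cof}(\mathcal{M})=\max\{\mathrm{cof}(\mathcal{H}_F): F\in\omega^\omega\text{ increasing}\}$.
   Context: $\mathcal{M}$ is the $\sigma$-ideal of meager subsets of $2^\omega$. $F\in\omega^\omega$ is increasing if $F(n)<F(n+1)$ for all $n$; we also assume $F(n)\geq 1$ for all $n$. $\Pi F=\prod_{n\in\omega}F(n)=\{x\in\omega^\omega: x(n)<F(n)\text{ for all } n\}$ with the product topology. An interval partition is a partition $I=(I_n)_{n\in\omega}$ of $\omega$ into consecutive finite nonempty intervals. $\mathcal{H}_F$ is the $\sigma$-ideal on $\Pi F$ generated by the sets $H_{I,y}=\{x\in\Pi F:\text{for all but finitely many } n\in\omega \text{ there is } k\in I_n \text{ with } x(k)=y(k)\}$, where $I$ is an interval partition and $y\in\Pi F$. For a $\sigma$-ideal $\mathcal{I}$: $\mathrm{add}(\mathcal{I})=\min\{|\mathcal{F}|:\mathcal{F}\subseteq\mathcal{I},\ \bigcup\mathcal{F}\notin\mathcal{I}\}$ and $\mathrm{cof}(\mathcal{I})=\min\{|\mathcal{F}|:\mathcal{F}\subseteq\mathcal{I},\ \forall Y\in\mathcal{I}\ \exists Y'\in\mathcal{F}\ Y\subseteq Y'\}$. -}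

module Defs where

open import Level using (Level; 0ℓ; _⊔_) renaming (suc to lsuc)
open import Data.Bool.Base using (Bool)
open import Data.Fin.Base using (Fin)
open import Data.Nat.Base using (ℕ; zero; suc; _≤_; _<_)
open import Data.Product.Base using (Σ-syntax; ∃-syntax; _×_; _,_)
open import Function.Bundles using (_↣_; _⤖_)
open import Function.Definitions using (Injective)
open import Relation.Binary.PropositionalEquality.Core using (_≡_)
open import Relation.Unary using (Pred; _∈_; _∉_; _⊆_; _≐_; ∅; ⋃; Empty)

-- Subsets of X are predicates X → Set, and two of them are the same subset
-- when they are related by _≐_.
Subset : Set → Set₁
Subset X = Pred X 0ℓ

-- The least σ-ideal containing a collection of subsets.
data σ-ideal⟨_⟩ {X : Set} {ℓ : Level} (𝓢 : Pred (Subset X) ℓ)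
       : Pred (Subset X) (lsuc 0ℓ ⊔ ℓ) where
  generator : ∀ {A} → A ∈ 𝓢 → A ∈ σ-ideal⟨ 𝓢 ⟩
  empty     : ∅ ∈ σ-ideal⟨ 𝓢 ⟩
  subset    : ∀ {A B} → A ⊆ B → B ∈ σ-ideal⟨ 𝓢 ⟩ → A ∈ σ-ideal⟨ 𝓢 ⟩
  union     : ∀ (A : ℕ → Subset X) → (∀ n → A n ∈ σ-ideal⟨ 𝓢 ⟩) →
              ⋃ ℕ A ∈ σ-ideal⟨ 𝓢 ⟩

2^ω : Set
2^ω = ℕ → Bool

-- The sets { y : y agrees with x below n }, n ∈ ℕ, form a neighbourhood base
-- at x for the product topology.
AgreeBelow : ℕ → 2^ω → 2^ω → Set
AgreeBelow n x y = ∀ k → k < n → y k ≡ x k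

closure : Subset 2^ω → Subset 2^ω
closure A x = ∀ n → ∃[ y ] AgreeBelow n x y × y ∈ A

interior : Subset 2^ω → Subset 2^ω
interior A x = ∃[ n ] (∀ y → AgreeBelow n x y → y ∈ A)

NowhereDense : Subset 2^ω → Set
NowhereDense A = Empty (interior (closure A))

𝓜 : Pred (Subset 2^ω) (lsuc 0ℓ)
𝓜 A = Σ[ N ∈ (ℕ → Subset 2^ω) ] (∀ n → NowhereDense (N n)) × A ≐ ⋃ ℕ N

record IncreasingFunction : Set where
  field
    fun        : ℕ → ℕ
    increasing : ∀ n → fun n < fun (suc n)
    positive   : ∀ n → 1 ≤ fun n

open IncreasingFunction public

-- The interval I_n is [ endpoint n , endpoint (suc n) ).
record IntervalPartition : Set where
  field
    endpoint      : ℕ → ℕ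
    endpoint-zero : endpoint zero ≡ zero
    endpoint-<    : ∀ n → endpoint n < endpoint (suc n)

open IntervalPartition public

interval : IntervalPartition → ℕ → Subset ℕ
interval I n k = endpoint I n ≤ k × k < endpoint I (suc n)

Π : IncreasingFunction → Set
Π F = (n : ℕ) → Fin (fun F n)

H : (F : IncreasingFunction) → IntervalPartition → Π F → Subset (Π F)
H F I y x = ∃[ m ] (∀ n → m ≤ n → ∃[ k ] k ∈ interval I n × x k ≡ y k)

𝓗 : (F : IncreasingFunction) → Pred (Subset (Π F)) (lsuc 0ℓ)
𝓗 F = σ-ideal⟨ (λ A → ∃[ I ] ∃[ y ] A ≐ H F I y) ⟩

-- Cardinals are represented by types κ : Set, compared by injections and
-- identified along bijections.  A family 𝓕 of subsets with |𝓕| = κ is an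
-- enumeration of 𝓕 by κ without repetitions.  No cardinality is lost by taking
-- κ in Set: classically every subset of X is given by some X → Bool, so the
-- whole power set of X : Set already has the size of a type in Set.
Family : Set → Set → Set₁
Family X κ = Σ[ A ∈ (κ → Subset X) ] Injective _≡_ _≐_ A

module _ {X : Set} (𝓘 : Pred (Subset X) (lsuc 0ℓ)) where

  AddSize : Set → Set₁
  AddSize κ = Σ[ (A , _) ∈ Family X κ ] (∀ i → A i ∈ 𝓘) × ⋃ κ A ∉ 𝓘

  CofSize : Set → Set₁
  CofSize κ = Σ[ (A , _) ∈ Family X κ ]
    (∀ i → A i ∈ 𝓘) × (∀ Y → Y ∈ 𝓘 → ∃[ i ] Y ⊆ A i)

IsLeast : (Set → Set₁) → Set → Set₁
IsLeast P κ = P κ × (∀ ν → P ν → κ ↣ ν)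

IsAdd : {X : Set} → Pred (Subset X) (lsuc 0ℓ) → Set → Set₁
IsAdd 𝓘 κ = IsLeast (AddSize 𝓘) κ

IsCof : {X : Set} → Pred (Subset X) (lsuc 0ℓ) → Set → Set₁
IsCof 𝓘 κ = IsLeast (CofSize 𝓘) κ

IsMin : {T : Set} → (T → Set) → Set → Set
IsMin μ κ = (∃[ t ] κ ⤖ μ t) × (∀ t → κ ↣ μ t)

IsMax : {T : Set} → (T → Set) → Set → Set
IsMax μ κ = (∃[ t ] κ ⤖ μ t) × (∀ t → μ t ↣ κ)

{-# OPTIONS --safe #-}
module Submission where

open import Defs
open import Axiom.ExcludedMiddle using (ExcludedMiddle)
open import Axiom.Extensionality.Propositional using (Extensionality)
open import Axiom.UniquenessOfIdentityProofs.WithK using (uip)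
open import Level using (0ℓ) renaming (suc to lsuc)
open import Data.Bool.Base using (Bool; true; false; not; T)
open import Data.Bool.Properties using (T-irrelevant; not-¬; ¬-not; not-involutive)
open import Data.Empty using (⊥; ⊥-elim)
open import Data.Fin.Base using (Fin; zero; suc; toℕ; fromℕ<)
open import Data.Fin.Properties using (toℕ<n; toℕ-injective)
open import Data.Nat.Base using (ℕ; zero; suc; _+_; _≤_; _<_; _⊔_; z≤n; s≤s; _≡ᵇ_)
open import Data.Nat.Properties
open import Data.Product.Base using (Σ; Σ-syntax; ∃; ∃-syntax; _×_; _,_; proj₁; proj₂)
open import Data.Sum.Base using (_⊎_; inj₁; inj₂)
open import Function.Base using (_∘_; id)
open import Function.Bundles using (_↣_; _⤖_; mk↣; mk⤖; Injection)
open import Function.Construct.Composition using (_↣-∘_)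
open import Relation.Binary.PropositionalEquality
open import Relation.Nullary using (¬_; Dec; yes; no)
open import Relation.Nullary.Decidable using (isYes; toWitness; fromWitness)
open import Relation.Unary using (Pred; _∈_; _⊆_; _≐_)
open import Relation.Unary.Properties using (≐-refl; ≐-sym; ≐-trans)

-- Write B(I,y) for the set of x that meet y on almost every Iₙ; in 2^ω this is
-- "x differs from the complement of y on almost every Iₙ".  These sets are cofinal
-- both in 𝓜 and in 𝓗_F (the countable unions of them are absorbed by a fusion
-- argument), and in each of the spaces
--   B(I,y) ⊆ B(K,z)  iff  for almost all n some Iₘ ⊆ Kₙ has z = y on Iₘ.
-- This condition is purely about copying blocks, so coding one product space
-- into another one blockwise yields Tukey maps 𝓜 → 𝓗_F → 𝓜 for every F.
-- Hence add(𝓗_F) = add(𝓜) and cof(𝓗_F) = cof(𝓜) for every F, and the minimum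
-- and the maximum are attained anywhere.

-- Interval partitions and the copying order on codes.

module StrictlyIncreasing (f : ℕ → ℕ) (f-< : ∀ n → f n < f (suc n)) where

  mono-≤ : ∀ {m n} → m ≤ n → f m ≤ f n
  mono-≤ {m} {n} m≤n with m≤n⇒m<n∨m≡n m≤n
  ... | inj₂ refl = ≤-refl
  mono-≤ {m} {suc n} _ | inj₁ (s≤s m≤n) = ≤-trans (mono-≤ m≤n) (<⇒≤ (f-< n))

  cancel-≤ : ∀ {m n} → f m ≤ f n → m ≤ n
  cancel-≤ {m} {n} p = ≮⇒≥ λ n<m → <⇒≱ (f-< n) (≤-trans (mono-≤ n<m) p)

  n≤f : ∀ n → n ≤ f n
  n≤f zero = z≤n
  n≤f (suc n) = ≤-<-trans (n≤f n) (f-< n)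

module Endpoint (I : IntervalPartition) = StrictlyIncreasing (endpoint I) (endpoint-< I)

locate : ∀ I k → ∃ λ n → k ∈ interval I n
locate I zero = 0 , ≤-reflexive (endpoint-zero I) , ≤-<-trans z≤n (endpoint-< I 0)
locate I (suc k) with n , a , b ← locate I k with suc k <? endpoint I (suc n)
... | yes k<e = n , m≤n⇒m≤1+n a , k<e
... | no k≮e = suc n , ≮⇒≥ k≮e , ≤-<-trans b (endpoint-< I (suc n))

interval-unique : ∀ I {k m n} → k ∈ interval I m → k ∈ interval I n → m ≡ n
interval-unique I (a , b) (c , d) = ≤-antisym (half a d) (half c b)
  where
  half : ∀ {k m n} → endpoint I m ≤ k → k < endpoint I (suc n) → m ≤ n
  half a d = ≮⇒≥ λ n<m → <⇒≱ d (≤-trans (Endpoint.mono-≤ I n<m) a)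

locate-unique : ∀ I {k n} → k ∈ interval I n → proj₁ (locate I k) ≡ n
locate-unique I k∈ = interval-unique I (proj₂ (locate I _)) k∈

Coded : (ℕ → Set) → Set
Coded Y = IntervalPartition × (∀ n → Y n)

-- For Y n = Fin (F n) this is H F I y, and for Y n = Bool it is the set of x
-- which on almost every Iₙ differ from the complement of y.
Hits : {Y : ℕ → Set} → Coded Y → Subset (∀ n → Y n)
Hits (I , y) x = ∃[ m ] (∀ n → m ≤ n → ∃[ k ] k ∈ interval I n × x k ≡ y k)

AgreeOn : {Y : ℕ → Set} → ℕ → ℕ → (∀ n → Y n) → (∀ n → Y n) → Set
AgreeOn a b z y = ∀ k → a ≤ k → k < b → z k ≡ y k

module _ {Y : ℕ → Set} (b : ℕ) (w w′ : ∀ n → Y n) where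

  splice : ∀ n → Y n
  splice k with k <? b
  ... | yes _ = w k
  ... | no _  = w′ k

  splice-< : ∀ {k} → k < b → splice k ≡ w k
  splice-< {k} k<b with k <? b
  ... | yes _  = refl
  ... | no k≮b = ⊥-elim (k≮b k<b)

  splice-≥ : ∀ {k} → b ≤ k → splice k ≡ w′ k
  splice-≥ {k} b≤k with k <? b
  ... | yes k<b = ⊥-elim (<⇒≱ k<b b≤k)
  ... | no _    = refl

Copy : {Y : ℕ → Set} → Coded Y → ℕ → (∀ n → Y n) → ℕ → Set
Copy (I , y) a z b = ∃ λ m → a ≤ endpoint I m × endpoint I (suc m) ≤ b ×
                     (∀ k → k ∈ interval I m → z k ≡ y k)

_≼_ : {Y : ℕ → Set} → Coded Y → Coded Y → Set
c ≼ (K , z) = ∃ λ N → ∀ n → N ≤ n → Copy c (endpoint K n) z (endpoint K (suc n))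

≼⇒⊆ : {Y : ℕ → Set} (c d : Coded Y) → c ≼ d → Hits c ⊆ Hits d
-- The threshold `endpoint I M` forces the copied interval to have index at least `M`.
≼⇒⊆ (I , y) (K , z) (N , copy) {x} (M , hit) = N ⊔ endpoint I M , λ n N⊔e≤n →
  let m , a , b , agree = copy n (m⊔n≤o⇒m≤o N _ N⊔e≤n)
      e≤Kn = ≤-trans (m⊔n≤o⇒n≤o N _ N⊔e≤n) (Endpoint.n≤f K n)
      k , (p , q) , e = hit m (Endpoint.cancel-≤ I (≤-trans e≤Kn a))
  in k , (≤-trans a p , <-≤-trans q b) , trans e (sym (agree k (p , q)))

singletons : IntervalPartition
singletons = record { endpoint = id ; endpoint-zero = refl ; endpoint-< = λ _ → ≤-refl }

module _ (i : ℕ) (c : Bool) (w : 2^ω) where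

  update : 2^ω
  update k with k ≟ i
  ... | yes _ = c
  ... | no _  = w k

  update-≡ : update i ≡ c
  update-≡ with i ≟ i
  ... | yes _  = refl
  ... | no i≢i = ⊥-elim (i≢i refl)

  update-> : ∀ {k} → i < k → update k ≡ w k
  update-> {k} i<k with k ≟ i
  ... | yes refl = ⊥-elim (<-irrefl refl i<k)
  ... | no _     = refl

module Classical (em : ∀ ℓ → ExcludedMiddle ℓ) (ext : ∀ a b → Extensionality a b) where

  dec : (P : Set) → Dec P
  dec P = em 0ℓ {P}

  ¬∀⇒∃¬ : {A : Set} {P : A → Set} → ¬ (∀ a → P a) → ∃ λ a → ¬ P a
  ¬∀⇒∃¬ {A} {P} ¬∀ with dec (∃ λ a → ¬ P a)
  ... | yes e = e
  ... | no ¬e = ⊥-elim (¬∀ λ a → by-contradiction a (dec (P a)))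
    where
    by-contradiction : ∀ a → Dec (P a) → P a
    by-contradiction a (yes p) = p
    by-contradiction a (no ¬p) = ⊥-elim (¬e (a , ¬p))

  -- Cantor-Bernstein and least cardinals.

  module CantorBernstein {A B : Set} (f : A ↣ B) (g : B ↣ A) where
    open Injection f using () renaming (to to f⟨_⟩; injective to f-injective)
    open Injection g using () renaming (to to g⟨_⟩; injective to g-injective)

    -- The points whose backward orbit under `g` and `f` stops outside the image of `g`. The
    -- bijection follows `f` on them and the inverse of `g` elsewhere.
    data Chain : A → Set where
      start : ∀ {a} → (∀ b → g⟨ b ⟩ ≢ a) → Chain a
      next  : ∀ {a} → Chain a → Chain g⟨ f⟨ a ⟩ ⟩

    g-preimage : ∀ {a} → ¬ Chain a → ∃ λ b → g⟨ b ⟩ ≡ a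
    g-preimage {a} ¬c with dec (∃ λ b → g⟨ b ⟩ ≡ a)
    ... | yes p = p
    ... | no ¬p = ⊥-elim (¬c (start λ b e → ¬p (b , e)))

    Chain-next⁻¹ : ∀ {a a′} → Chain a′ → a′ ≡ g⟨ f⟨ a ⟩ ⟩ → Chain a
    Chain-next⁻¹ (start s) e = ⊥-elim (s _ (sym e))
    Chain-next⁻¹ (next c)  e = subst Chain (f-injective (g-injective e)) c

    h′ : ∀ a → Dec (Chain a) → B
    h′ a (yes _) = f⟨ a ⟩
    h′ a (no ¬c) = proj₁ (g-preimage ¬c)

    h′-injective : ∀ {a a′} (c : Dec (Chain a)) (c′ : Dec (Chain a′)) →
                   h′ a c ≡ h′ a′ c′ → a ≡ a′
    h′-injective (yes _) (yes _) e = f-injective e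
    h′-injective (yes c) (no ¬c) e = ⊥-elim (¬c (subst Chain
      (trans (cong g⟨_⟩ e) (proj₂ (g-preimage ¬c))) (next c)))
    h′-injective (no ¬c) (yes c) e = ⊥-elim (¬c (subst Chain
      (trans (cong g⟨_⟩ (sym e)) (proj₂ (g-preimage ¬c))) (next c)))
    h′-injective (no ¬c) (no ¬c′) e =
      trans (sym (proj₂ (g-preimage ¬c))) (trans (cong g⟨_⟩ e) (proj₂ (g-preimage ¬c′)))

    h′-no : ∀ {b} (c : Dec (Chain g⟨ b ⟩)) → ¬ Chain g⟨ b ⟩ → h′ g⟨ b ⟩ c ≡ b
    h′-no (yes c) ¬c = ⊥-elim (¬c c)
    h′-no (no ¬c) _  = g-injective (proj₂ (g-preimage ¬c))

    h′-yes : ∀ {a} (c : Dec (Chain a)) → Chain a → h′ a c ≡ f⟨ a ⟩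
    h′-yes (yes _) _ = refl
    h′-yes (no ¬c) c = ⊥-elim (¬c c)

    predecessor : ∀ {a b} → Chain a → a ≡ g⟨ b ⟩ → ∃ λ a′ → Chain a′ × f⟨ a′ ⟩ ≡ b
    predecessor (start s) e = ⊥-elim (s _ (sym e))
    predecessor (next {a} c) e = a , c , g-injective e

    h : A → B
    h a = h′ a (dec (Chain a))

    h-surjective : ∀ b → ∃ λ a → h a ≡ b
    h-surjective b with dec (Chain g⟨ b ⟩)
    ... | no ¬c = g⟨ b ⟩ , h′-no (dec _) ¬c
    ... | yes c with a , d , e ← predecessor c refl = a , trans (h′-yes (dec _) d) e

    bijection : A ⤖ B
    bijection = mk⤖
      ( (λ {a} {a′} → h′-injective (dec (Chain a)) (dec (Chain a′)))
      , λ b → let a , e = h-surjective b in a , λ z≡a → trans (cong h z≡a) e )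

  -- Subsets of W are represented as W → Bool, so that they form a type in Set.
  module _ {W : Set} where

    ⟦_⟧ : (W → Set) → (W → Bool)
    ⟦ P ⟧ w = isYes (dec (P w))

    infix 4 _∈ᵇ_ _⊆ᵇ_

    _∈ᵇ_ : W → (W → Bool) → Set
    w ∈ᵇ S = T (S w)

    _⊆ᵇ_ : (W → Bool) → (W → Bool) → Set
    S ⊆ᵇ R = ∀ w → w ∈ᵇ S → w ∈ᵇ R

    ⊆ᵇ-antisym : ∀ {S R} → S ⊆ᵇ R → R ⊆ᵇ S → S ≡ R
    ⊆ᵇ-antisym {S} {R} p q = ext _ _ λ w → T-ext (S w) (R w) (p w) (q w)
      where
      T-ext : ∀ a b → (T a → T b) → (T b → T a) → a ≡ b
      T-ext true  true  _ _ = refl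
      T-ext false false _ _ = refl
      T-ext true  false p _ = ⊥-elim (p _)
      T-ext false true  _ q = ⊥-elim (q _)

    ⋃ᵇ : ((W → Bool) → Bool) → (W → Bool)
    ⋃ᵇ 𝒞 = ⟦ (λ w → ∃ λ S → T (𝒞 S) × w ∈ᵇ S) ⟧

  El : {W : Set} → (W → Bool) → Set
  El S = ∃ λ w → w ∈ᵇ S

  El-≡ : {W : Set} {S : W → Bool} {a b : El S} → proj₁ a ≡ proj₁ b → a ≡ b
  El-≡ {a = _ , p} {_ , q} refl = cong (_ ,_) (T-irrelevant p q)

  -- Among sets S of choice functions no two of which agree anywhere, a maximal
  -- one projects onto some A i, and then A i ↣ S ↣ A j for every j.  A maximal
  -- one is found as the union of a Bourbaki–Witt tower.
  module LeastCardinal {I : Set} (i₀ : I) (A : I → Set) where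

    W : Set
    W = ∀ i → A i

    Extendable : (W → Bool) → Set
    Extendable S = ∀ i → Σ[ a ∈ A i ] (∀ w → w ∈ᵇ S → w i ≢ a)

    IsNew : ∀ {S} → Dec (Extendable S) → W → Set
    IsNew (yes e) w = ∀ i → w i ≡ proj₁ (e i)
    IsNew (no _)  w = ⊥

    extend : (W → Bool) → (W → Bool)
    extend S = ⟦ (λ w → w ∈ᵇ S ⊎ IsNew (dec (Extendable S)) w) ⟧

    ⊆-extend : ∀ S → S ⊆ᵇ extend S
    ⊆-extend S w p = fromWitness (inj₁ p)

    data Tower : (W → Bool) → Set where
      step : ∀ {S} → Tower S → Tower (extend S)
      sup  : ∀ 𝒞 → (∀ S → T (𝒞 S) → Tower S) → Tower (⋃ᵇ 𝒞)

    -- At a successor the comparison is repeated with the roles exchanged. If `R` and `S` then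
    -- contain each other they are equal, and so are their extensions.
    compare : ∀ {S R} → Tower S → Tower R → R ⊆ᵇ S ⊎ extend S ⊆ᵇ R
    compare s (step {R} r) with compare s r
    ... | inj₂ q = inj₂ λ w p → ⊆-extend R w (q w p)
    ... | inj₁ R⊆S with compare r s
    ...   | inj₂ q = inj₁ q
    ...   | inj₁ S⊆R with refl ← ⊆ᵇ-antisym R⊆S S⊆R = inj₂ λ _ p → p
    compare {S} s (sup 𝒞 c) with dec (∃ λ R → T (𝒞 R) × extend S ⊆ᵇ R)
    ... | yes (R , R∈𝒞 , q) = inj₂ λ w p → fromWitness (R , R∈𝒞 , q w p)
    ... | no ¬q = inj₁ λ w p →
      let R , R∈𝒞 , w∈R = toWitness p in below R R∈𝒞 (compare s (c R R∈𝒞)) w w∈R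
      where
      below : ∀ R → T (𝒞 R) → R ⊆ᵇ S ⊎ extend S ⊆ᵇ R → R ⊆ᵇ S
      below R _   (inj₁ p) = p
      below R R∈𝒞 (inj₂ q) = ⊥-elim (¬q (R , R∈𝒞 , q))

    Matching : (W → Bool) → Set
    Matching S = ∀ {w v} → w ∈ᵇ S → v ∈ᵇ S → ∀ i → w i ≡ v i → w ≡ v

    matching-extend : ∀ S → Matching S → Matching (extend S)
    matching-extend S m {w} {v} p q i e with dec (Extendable S) | toWitness p | toWitness q
    ... | _      | inj₁ p | inj₁ q = m p q i e
    ... | yes x  | inj₁ p | inj₂ q = ⊥-elim (proj₂ (x i) w p (trans e (q i)))
    ... | yes x  | inj₂ p | inj₁ q = ⊥-elim (proj₂ (x i) v q (trans (sym e) (p i)))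
    ... | yes x  | inj₂ p | inj₂ q = ext _ _ λ j → trans (p j) (sym (q j))

    tower-matching : ∀ {S} → Tower S → Matching S
    tower-matching (step {S} s) = matching-extend S (tower-matching s)
    tower-matching (sup 𝒞 c) p q i e
      with S , S∈𝒞 , w∈S ← toWitness p | R , R∈𝒞 , v∈R ← toWitness q
      with compare (c S S∈𝒞) (c R R∈𝒞)
    ... | inj₁ R⊆S = tower-matching (c S S∈𝒞) w∈S (R⊆S _ v∈R) i e
    ... | inj₂ S⊆R = tower-matching (c R R∈𝒞) (S⊆R _ (⊆-extend S _ w∈S)) v∈R i e

    top : W → Bool
    top = ⋃ᵇ ⟦ Tower ⟧

    top-tower : Tower top
    top-tower = sup ⟦ Tower ⟧ λ _ → toWitness

    -- `extend top` is again in the tower, hence contained in `top`; a function added to `top` would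
    -- have to differ from itself at `i₀`.
    top-maximal : ¬ Extendable top
    top-maximal e = absurd (dec (Extendable top)) λ w n →
      fromWitness (extend top , fromWitness (step top-tower) , fromWitness (inj₂ n))
      where
      absurd : (d : Dec (Extendable top)) → (∀ w → IsNew d w → w ∈ᵇ top) → ⊥
      absurd (no ¬x) _ = ¬x e
      absurd (yes x) closed = proj₂ (x i₀) (λ i → proj₁ (x i)) (closed _ λ _ → refl) refl

    covered : ∃ λ i → ∀ a → ∃ λ w → w ∈ᵇ top × w i ≡ a
    covered with i , ¬x ← ¬∀⇒∃¬ top-maximal = i , λ a → cover i ¬x a (dec _)
      where
      cover : ∀ i → ¬ (Σ[ a ∈ A i ] (∀ w → w ∈ᵇ top → w i ≢ a)) → ∀ a →
              Dec (∃ λ w → w ∈ᵇ top × w i ≡ a) → ∃ λ w → w ∈ᵇ top × w i ≡ a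
      cover i ¬x a (yes p) = p
      cover i ¬x a (no ¬p) = ⊥-elim (¬x (a , λ w m e → ¬p (w , m , e)))

    least : ∃ λ i → ∀ j → A i ↣ A j
    least with i , cov ← covered = i , λ j → mk↣ {to = λ a → proj₁ (cov a) j} λ {a} {b} e →
      let w , w∈ , wa = cov a
          v , v∈ , vb = cov b
      in trans (sym wa) (trans (cong (λ u → u i) (tower-matching top-tower w∈ v∈ j e)) vb)

  -- Additivity and cofinality computed from a base.

  choose : {A : Set} (S : A → Bool) → Dec (El S) → A → A
  choose S (yes (a , _)) _ = a
  choose S (no _) a = a

  choose-∈ : {A : Set} (S : A → Bool) (d : Dec (El S)) {a : A} → a ∈ᵇ S → choose S d a ∈ᵇ S
  choose-∈ S (yes (_ , p)) _ = p
  choose-∈ S (no ¬e) p = ⊥-elim (¬e (_ , p))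

  choose-irrelevant : {A : Set} (S : A → Bool) (d : Dec (El S)) {a b : A} →
                      a ∈ᵇ S → choose S d a ≡ choose S d b
  choose-irrelevant S (yes _) _ = refl
  choose-irrelevant S (no ¬e) p = ⊥-elim (¬e (_ , p))

  -- Since classes are Bool-valued, equivalent i have equal classes, whence equal
  -- chosen representatives.
  module RemoveRepetitions {X ν : Set} (A : ν → Subset X) where

    class : ν → (ν → Bool)
    class i = ⟦ (λ j → A i ≐ A j) ⟧

    rep : ν → ν
    rep i = choose (class i) (dec _) i

    self : ∀ i → i ∈ᵇ class i
    self i = fromWitness (≐-refl {x = A i})

    rep-≐ : ∀ i → A i ≐ A (rep i)
    rep-≐ i = toWitness (choose-∈ (class i) (dec _) (self i))

    class-cong : ∀ {i j} → A i ≐ A j → class i ≡ class j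
    class-cong e = ⊆ᵇ-antisym
      (λ k f → fromWitness (≐-trans (≐-sym e) (toWitness f)))
      (λ k f → fromWitness (≐-trans e (toWitness f)))

    rep-cong : ∀ {i j} → A i ≐ A j → rep i ≡ rep j
    rep-cong {i} {j} e = trans (choose-irrelevant (class i) (dec _) {i} {j} (self i))
                               (cong (λ S → choose S (dec _) j) (class-cong e))

    κ : Set
    κ = ∃ λ i → rep i ≡ i

    κ↣ν : κ ↣ ν
    κ↣ν = mk↣ {to = proj₁} λ { {i , p} {_ , q} refl → cong (i ,_) (uip p q) }

    family : Family X κ
    family = A ∘ proj₁ ,
      λ { {i , p} {j , q} e → Injection.injective κ↣ν (trans (sym p) (trans (rep-cong e) q)) }

    represent : ∀ i → ∃ λ k → A i ≐ proj₁ family k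
    represent i = (rep i , sym (rep-cong (rep-≐ i))) , rep-≐ i

  -- A cofinal part of the ideal, indexed by a type in `Set`. The sets of codes then form a small
  -- type, in which a least cardinality can be found.
  record Base {X : Set} (𝓘 : Pred (Subset X) (lsuc 0ℓ)) : Set₁ where
    field
      Code       : Set
      B          : Code → Subset X
      B∈         : ∀ c → B c ∈ 𝓘
      bound      : ∀ {A} → A ∈ 𝓘 → ∃ λ c → A ⊆ B c
      downwards  : ∀ {A A′} → A ⊆ A′ → A′ ∈ 𝓘 → A ∈ 𝓘

    Unbounded : {ν : Set} → (ν → Code) → Set
    Unbounded f = ¬ ∃ λ d → ∀ i → B (f i) ⊆ B d

    Cofinal : {ν : Set} → (ν → Code) → Set
    Cofinal f = ∀ d → ∃ λ i → B d ⊆ B (f i)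

    AddSize⇒Unbounded : ∀ {ν} → AddSize 𝓘 ν → Σ (ν → Code) Unbounded
    AddSize⇒Unbounded ((A , _) , A∈ , ⋃∉) = (λ i → proj₁ (bound (A∈ i))) ,
      λ (d , b) → ⋃∉ (downwards (λ (i , x∈) → b i (proj₂ (bound (A∈ i)) x∈)) (B∈ d))

    CofSize⇒Cofinal : ∀ {ν} → CofSize 𝓘 ν → Σ (ν → Code) Cofinal
    CofSize⇒Cofinal ((A , _) , A∈ , cof) = (λ i → proj₁ (bound (A∈ i))) ,
      λ d → let i , p = cof (B d) (B∈ d) in i , proj₂ (bound (A∈ i)) ∘ p

    -- Different codes may give the same set; thinning out repetitions leaves only `κ ↣ ν`.
    Unbounded⇒AddSize : ∀ {ν} (f : ν → Code) → Unbounded f → ∃ λ κ → (κ ↣ ν) × AddSize 𝓘 κ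
    Unbounded⇒AddSize f unb = κ , κ↣ν , family , (λ k → B∈ (f (proj₁ k))) ,
      λ ⋃∈ → let d , p = bound ⋃∈ in
        unb (d , λ i x∈ → let k , q , _ = represent i in p (k , q x∈))
      where open RemoveRepetitions (B ∘ f)

    Cofinal⇒CofSize : ∀ {ν} (f : ν → Code) → Cofinal f → ∃ λ κ → (κ ↣ ν) × CofSize 𝓘 κ
    Cofinal⇒CofSize f cof = κ , κ↣ν , family , (λ k → B∈ (f (proj₁ k))) ,
      λ Y Y∈ → let d , p = bound Y∈
                   i , q = cof d
                   k , r , _ = represent i
               in k , r ∘ q ∘ p
      where open RemoveRepetitions (B ∘ f)

  -- As `Φ` passes from a family to its range, only subsets of `C` compete, and `LeastCardinal`
  -- applies to them. `Φ⇒Size` may shrink the least one, but `κ` still injects into every range and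
  -- hence into every `ν`.
  IsLeast-exists :
    {C : Set} (Φ : {ν : Set} → (ν → C) → Set) (Size : Set → Set₁) →
    (∀ {ν ν′} {f : ν → C} {g : ν′ → C} → (∀ i → ∃ λ j → f i ≡ g j) → Φ f → Φ g) →
    (∀ {ν} → Size ν → Σ (ν → C) Φ) →
    (∀ {ν} (f : ν → C) → Φ f → ∃ λ κ → (κ ↣ ν) × Size κ) →
    {ν : Set} (f : ν → C) → Φ f → ∃ (IsLeast Size)
  IsLeast-exists {C} Φ Size mono Size⇒Φ Φ⇒Size f Φf = κ , size , minimal
    where
    image : {ν : Set} → (ν → C) → C → Bool
    image g = ⟦ (λ c → ∃ λ i → g i ≡ c) ⟧

    image-Φ : {ν : Set} (g : ν → C) → Φ g → Φ {El (image g)} proj₁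
    image-Φ g = mono λ i → (g i , fromWitness (i , refl)) , refl

    image-↣ : {ν : Set} (g : ν → C) → El (image g) ↣ ν
    image-↣ g = mk↣ {to = λ (_ , m) → proj₁ (toWitness m)} λ { {_ , m} {_ , n} e →
      El-≡ (trans (sym (proj₂ (toWitness m))) (trans (cong g e) (proj₂ (toWitness n)))) }

    I : Set
    I = Σ (C → Bool) λ S → Φ {El S} proj₁

    minimum : Σ[ S ∈ I ] (∀ R → El (proj₁ S) ↣ El (proj₁ R))
    minimum = LeastCardinal.least (image f , image-Φ f Φf) (El ∘ proj₁)

    S* : I
    S* = proj₁ minimum

    shrunk : ∃ λ κ → (κ ↣ El (proj₁ S*)) × Size κ
    shrunk = Φ⇒Size proj₁ (proj₂ S*)

    κ : Set
    κ = proj₁ shrunk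

    size : Size κ
    size = proj₂ (proj₂ shrunk)

    minimal : ∀ ν → Size ν → κ ↣ ν
    minimal ν s with g , Φg ← Size⇒Φ s =
      image-↣ g ↣-∘ (proj₂ minimum (image g , image-Φ g Φg) ↣-∘ proj₁ (proj₂ shrunk))

  module _ {X : Set} {𝓘 : Pred (Subset X) (lsuc 0ℓ)} (𝓑 : Base 𝓘) where
    open Base 𝓑

    IsAdd-exists : Unbounded id → ∃ (IsAdd 𝓘)
    IsAdd-exists = IsLeast-exists Unbounded (AddSize 𝓘)
      (λ r unb (d , b) → unb (d , λ i → let j , e = r i in subst (λ c → B c ⊆ B d) (sym e) (b j)))
      AddSize⇒Unbounded Unbounded⇒AddSize id

    IsCof-exists : ∃ (IsCof 𝓘)
    IsCof-exists = IsLeast-exists Cofinal (CofSize 𝓘)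
      (λ r cof d → let i , p = cof d
                       j , e = r i
                   in j , subst (λ c → B d ⊆ B c) e p)
      CofSize⇒Cofinal Cofinal⇒CofSize id (λ d → d , id)

  -- Tukey maps between bases.

  record Tukey {X X′ : Set} {𝓘 : Pred (Subset X) (lsuc 0ℓ)} {𝓙 : Pred (Subset X′) (lsuc 0ℓ)}
               (𝓑 : Base 𝓘) (𝓒 : Base 𝓙) : Set where
    private
      module 𝓑 = Base 𝓑
      module 𝓒 = Base 𝓒
    field
      φ     : 𝓑.Code → 𝓒.Code
      ψ     : 𝓒.Code → 𝓑.Code
      tukey : ∀ c d → 𝓒.B (φ c) ⊆ 𝓒.B d → 𝓑.B c ⊆ 𝓑.B (ψ d)

    -- `φ` carries unbounded families to unbounded ones: a bound `d` of the images pulls back to the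
    -- bound `ψ d`.
    add-↣ : ∀ {κ ν} → IsAdd 𝓘 κ → IsAdd 𝓙 ν → ν ↣ κ
    add-↣ (size , _) (_ , minimal) =
      let f , unb = 𝓑.AddSize⇒Unbounded size
          κ′ , κ′↣κ , size′ = 𝓒.Unbounded⇒AddSize (φ ∘ f)
            λ (d , b) → unb (ψ d , λ i → tukey (f i) d (b i))
      in κ′↣κ ↣-∘ minimal κ′ size′

    -- Dually, `ψ` carries cofinal families to cofinal ones.
    cof-↣ : ∀ {κ ν} → IsCof 𝓘 κ → IsCof 𝓙 ν → κ ↣ ν
    cof-↣ (_ , minimal) (size , _) =
      let g , cof = 𝓒.CofSize⇒Cofinal size
          κ′ , κ′↣ν , size′ = 𝓑.Cofinal⇒CofSize (ψ ∘ g)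
            λ c → let i , p = cof (φ c) in i , tukey c (g i) p
      in κ′↣ν ↣-∘ minimal κ′ size′

  -- From inclusion to copying.

  even : ℕ → Bool
  even zero = true
  even (suc n) = not (even n)

  -- Coordinate 0 is exempt because `F 0` may be 1.
  Splits : (ℕ → Set) → Set
  Splits Y = ∀ k → 1 ≤ k → (a : Y k) → ∃ λ b → b ≢ a

  module _ {Y : ℕ → Set} (other : Splits Y) where

    -- If I has no copy in Kₙ for infinitely many n of one parity, then on these
    -- Kₙ let x avoid z, being equal to y wherever y ≠ z, and let x = y elsewhere.
    -- As no two of these Kₙ are adjacent, x meets y on every Iₘ.
    module Diagonal (I K : IntervalPartition) (y z : ∀ n → Y n) (parity : Bool) where

      CopyIn : ℕ → Set
      CopyIn n = Copy (I , y) (endpoint K n) z (endpoint K (suc n))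

      -- The clause `1 ≤ n` keeps 0 out of these intervals, so that `other` applies throughout them.
      Bad : ℕ → Set
      Bad n = 1 ≤ n × even n ≡ parity × ¬ CopyIn n

      ¬Bad-suc : ∀ {n} → Bad n → ¬ Bad (suc n)
      ¬Bad-suc (_ , refl , _) (_ , e , _) = not-¬ refl (sym e)

      value : ∀ k n → k ∈ interval K n → Dec (Bad n) → Dec (y k ≡ z k) → Y k
      value k n k∈ (yes (1≤n , _)) (yes _) =
        proj₁ (other k (≤-trans 1≤n (≤-trans (Endpoint.n≤f K n) (proj₁ k∈))) (z k))
      value k n k∈ (yes _) (no _) = y k
      value k n k∈ (no _) _ = y k

      value-≢ : ∀ k n k∈ d e → Bad n → value k n k∈ d e ≢ z k
      value-≢ k n k∈ (yes _) (yes _) _ = proj₂ (other k _ (z k))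
      value-≢ k n k∈ (yes _) (no ¬e) _ = ¬e
      value-≢ k n k∈ (no ¬b) _ b = ⊥-elim (¬b b)

      value-¬Bad : ∀ k n k∈ d e → ¬ Bad n → value k n k∈ d e ≡ y k
      value-¬Bad k n k∈ (yes b) _ ¬b = ⊥-elim (¬b b)
      value-¬Bad k n k∈ (no _) _ _ = refl

      value-differ : ∀ k n k∈ d e → y k ≢ z k → value k n k∈ d e ≡ y k
      value-differ k n k∈ (yes _) (yes e) ¬e = ⊥-elim (¬e e)
      value-differ k n k∈ (yes _) (no _) _ = refl
      value-differ k n k∈ (no _) _ _ = refl

      x : ∀ k → Y k
      x k = value k (proj₁ (locate K k)) (proj₂ (locate K k)) (dec _) (dec _)

      x≢z : ∀ {k n} → k ∈ interval K n → Bad n → x k ≢ z k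
      x≢z {k} k∈ b = value-≢ k _ _ (dec _) (dec _) (subst Bad (sym (locate-unique K k∈)) b)

      x≡y : ∀ {k n} → k ∈ interval K n → ¬ Bad n → x k ≡ y k
      x≡y {k} k∈ ¬b =
        value-¬Bad k _ _ (dec _) (dec _) (¬b ∘ subst Bad (locate-unique K k∈))

      -- Let `K n` contain the first point of `I m`. If it is not bad, that point works. If it is
      -- bad and `I m` sticks out, the first point of `K (suc n)` works by parity. If it is bad and
      -- contains `I m`, the lack of a copy gives a point with `y ≠ z`, where `x` keeps `y`.
      x∈Hits : x ∈ Hits (I , y)
      x∈Hits = 0 , λ m _ → hit m (locate K (endpoint I m)) (dec _)
        where
        hit : ∀ m → ((n , _) : ∃ λ n → endpoint I m ∈ interval K n) → Dec (Bad n) →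
              ∃ λ k → k ∈ interval I m × x k ≡ y k
        hit m (n , e∈) (no ¬b) = endpoint I m , (≤-refl , endpoint-< I m) , x≡y e∈ ¬b
        hit m (n , (p , q)) (yes b) with endpoint I (suc m) ≤? endpoint K (suc n)
        ... | no e≰ = endpoint K (suc n) , (<⇒≤ q , ≰⇒> e≰) ,
                      x≡y (≤-refl , endpoint-< K (suc n)) (¬Bad-suc b)
        ... | yes e≤ with dec (∃ λ k → k ∈ interval I m × y k ≢ z k)
        ...   | yes (k , k∈ , y≢z) = k , k∈ , value-differ k _ _ (dec _) (dec _) y≢z
        ...   | no ¬differ = ⊥-elim (proj₂ (proj₂ b) (m , p , e≤ , λ k k∈ → agree k k∈ (dec _)))
          where
          agree : ∀ k → k ∈ interval I m → Dec (y k ≡ z k) → z k ≡ y k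
          agree k k∈ (yes e) = sym e
          agree k k∈ (no ¬e) = ⊥-elim (¬differ (k , k∈ , ¬e))

      copies : Hits (I , y) ⊆ Hits (K , z) → ∃ λ N → ∀ n → N ≤ n → even n ≡ parity → CopyIn n
      copies sub with N , hit ← sub {x} x∈Hits = N ⊔ 1 , λ n N⊔1≤n e →
        good n (m⊔n≤o⇒m≤o N 1 N⊔1≤n) (m⊔n≤o⇒n≤o N 1 N⊔1≤n) e (dec _)
        where
        good : ∀ n → N ≤ n → 1 ≤ n → even n ≡ parity → Dec (CopyIn n) → CopyIn n
        good n N≤n 1≤n e (yes c) = c
        good n N≤n 1≤n e (no ¬c) =
          let k , k∈ , x≡z = hit n N≤n in ⊥-elim (x≢z k∈ (1≤n , e , ¬c) x≡z)

    ⊆⇒≼ : (c d : Coded Y) → Hits c ⊆ Hits d → c ≼ d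
    ⊆⇒≼ (I , y) (K , z) sub
      with N , f ← Diagonal.copies I K y z true (λ {x} → sub {x})
         | M , g ← Diagonal.copies I K y z false (λ {x} → sub {x}) = N ⊔ M , both
      where
      both : ∀ n → N ⊔ M ≤ n → Copy (I , y) (endpoint K n) z (endpoint K (suc n))
      both n p with even n in e
      ... | true  = f n (m⊔n≤o⇒m≤o N M p) e
      ... | false = g n (m⊔n≤o⇒n≤o N M p) e

    -- A `y` that differs from `z` off 0 leaves nothing to copy. This makes the family of all codes
    -- unbounded, so that the additivity exists.
    unbounded : (d : Coded Y) → ∃ λ c → ¬ (Hits c ⊆ Hits d)
    unbounded (K , z) = (K , y) , λ sub →
      let N , copy = ⊆⇒≼ (K , y) (K , z) (λ {x} → sub {x})
          -- With `suc N` in place of `N` the copied interval starts beyond 0, where `y` and `z`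
          -- differ.
          m , p , _ , agree = copy (suc N) (n≤1+n N)
          1≤e = ≤-trans (s≤s z≤n) (≤-trans (Endpoint.n≤f K (suc N)) p)
      in y≢z _ 1≤e (sym (agree (endpoint K m) (≤-refl , endpoint-< K m)))
      where
      y : ∀ k → Y k
      y zero = z zero
      y (suc k) = proj₁ (other (suc k) (s≤s z≤n) (z (suc k)))

      y≢z : ∀ k → 1 ≤ k → y k ≢ z k
      y≢z (suc k) _ = proj₂ (other (suc k) (s≤s z≤n) (z (suc k)))

  -- Fusion and countable directedness.

  -- R j a w b says that the values of w on [ a , b ) meet the requirement j.
  module Fusion {Y : ℕ → Set} (y₀ : ∀ n → Y n)
    (R : ℕ → ℕ → (∀ n → Y n) → ℕ → Set)
    (extendable : ∀ j a w b → ∃ λ w′ → ∃ λ b′ →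
                  b ≤ b′ × AgreeOn a b w′ w × R j a w′ b′)
    (local : ∀ j a w b w′ b′ → b ≤ b′ → AgreeOn a b w′ w →
             R j a w b → R j a w′ b′)
    where

    -- Requirements up to `n` are met in turn; each extension keeps the values chosen so far, so the
    -- earlier ones survive by `local`.
    stage : ∀ n a → ∃ λ w → ∃ λ b → a < b × (∀ j → j ≤ n → R j a w b)
    stage zero a with w , b , p , _ , r ← extendable 0 a y₀ (suc a) =
      w , b , p , λ { .0 z≤n → r }
    stage (suc n) a with w , b , a<b , rs ← stage n a
                    with w′ , b′ , b≤b′ , agree , r ← extendable (suc n) a w b =
      w′ , b′ , ≤-trans a<b b≤b′ , λ j j≤1+n → meet j (m≤n⇒m<n∨m≡n j≤1+n)
      where
      meet : ∀ j → j < suc n ⊎ j ≡ suc n → R j a w′ b′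
      meet j (inj₁ (s≤s j≤n)) = local j a w b w′ b′ b≤b′ agree (rs j j≤n)
      meet j (inj₂ refl) = r

    e : ℕ → ℕ
    e zero = 0
    e (suc n) = proj₁ (proj₂ (stage n (e n)))

    I : IntervalPartition
    I = record
      { endpoint = e
      ; endpoint-zero = refl
      ; endpoint-< = λ n → proj₁ (proj₂ (proj₂ (stage n (e n))))
      }

    w : ℕ → ∀ n → Y n
    w n = proj₁ (stage n (e n))

    y : ∀ k → Y k
    y k = w (proj₁ (locate I k)) k

    fusion : ∃ λ c → ∀ j n → j ≤ n → R j (endpoint (proj₁ c) n) (proj₂ c) (endpoint (proj₁ c) (suc n))
    fusion = (I , y) , λ j n j≤n →
      local j (e n) (w n) (e (suc n)) y (e (suc n)) ≤-refl
        (λ k p q → cong (λ i → w i k) (locate-unique I {n = n} (p , q)))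
        (proj₂ (proj₂ (proj₂ (stage n (e n)))) j j≤n)

  open Fusion using (fusion)

  -- Fusion in which requirement `i` asks for a copy of `c i`; this will absorb countable unions.
  ≼-directed : {Y : ℕ → Set} (c : ℕ → Coded Y) → ∃ λ d → ∀ i → c i ≼ d
  ≼-directed {Y} c =
    let d , r = fusion (proj₂ (c 0)) (λ i → Copy (c i)) extendable local
    in d , λ i → i , r i
    where
    local : ∀ i a w b w′ b′ → b ≤ b′ → AgreeOn a b w′ w →
            Copy (c i) a w b → Copy (c i) a w′ b′
    local i a w b w′ b′ b≤b′ agree (m , p , q , f) = m , p , ≤-trans q b≤b′ ,
      λ k (k≥ , k<) → trans (agree k (≤-trans p k≥) (<-≤-trans k< q)) (f k (k≥ , k<))

    extendable : ∀ i a w b → ∃ λ w′ → ∃ λ b′ →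
                 b ≤ b′ × AgreeOn a b w′ w × Copy (c i) a w′ b′
    -- From `b` on, follow the sequence of `c i`; its interval with index `a ⊔ b` starts at or
    -- beyond both `a` and `b`.
    extendable i a w b = splice b w (proj₂ (c i)) , endpoint Iᵢ (suc m) ,
      ≤-trans b≤e (<⇒≤ (endpoint-< Iᵢ m)) , (λ k _ → splice-< b _ _) ,
      m , ≤-trans (m≤m⊔n a b) (Endpoint.n≤f Iᵢ m) , ≤-refl ,
      λ k (p , _) → splice-≥ b _ _ (≤-trans b≤e p)
      where
      Iᵢ = proj₁ (c i)
      m = a ⊔ b
      b≤e : b ≤ endpoint Iᵢ m
      b≤e = ≤-trans (m≤n⊔m a b) (Endpoint.n≤f Iᵢ m)

  -- Blockwise coding of one product space in another.

  -- The value of y at k is coded by the values of enc y on [ p k , p (suc k) ).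
  module BlockCoding {Y Z : ℕ → Set} (y₀ : ∀ n → Y n) (z₀ : ∀ n → Z n)
    (p : ℕ → ℕ) (p-< : ∀ n → p n < p (suc n))
    (enc : (∀ n → Y n) → (∀ n → Z n))
    (enc-injective : ∀ y y′ k → AgreeOn (p k) (p (suc k)) (enc y) (enc y′) → y k ≡ y′ k)
    where
    private module p = StrictlyIncreasing p p-<

    CodedBy : (∀ n → Z n) → ℕ → Set
    CodedBy z k = ∃ λ y → AgreeOn (p k) (p (suc k)) z (enc y)

    -- By `enc-injective` any witness `y` gives the same value at `k`; blocks that are not codes get
    -- the default `y₀`.
    decode : ∀ z k → Dec (CodedBy z k) → Y k
    decode z k (yes (y , _)) = y k
    decode z k (no _) = y₀ k

    decode-enc : ∀ z k y → AgreeOn (p k) (p (suc k)) z (enc y) →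
                 (d : Dec (CodedBy z k)) → decode z k d ≡ y k
    decode-enc z k y e (yes (y′ , e′)) =
      enc-injective y′ y k λ j a b → trans (sym (e′ j a b)) (e j a b)
    decode-enc z k y e (no ¬e) = ⊥-elim (¬e (y , e))

    blocks : IntervalPartition → IntervalPartition
    blocks I = record { endpoint = f ; endpoint-zero = refl ; endpoint-< = f-< }
      where
      f : ℕ → ℕ
      -- `p 0` may be positive, as it is in `Shift`.
      f zero = 0
      f (suc n) = p (endpoint I (suc n))
      f-< : ∀ n → f n < f (suc n)
      f-< zero = ≤-trans (≤-<-trans z≤n (endpoint-< I 0)) (p.n≤f _)
      f-< (suc n) = ≤-trans (p-< _) (p.mono-≤ (endpoint-< I (suc n)))

    -- The blocks of [ a , endpoint K (suc (p a)) ) cover the interval of K with index p a.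
    coarsen : IntervalPartition → IntervalPartition
    coarsen K = record { endpoint = f ; endpoint-zero = refl ; endpoint-< = f-< }
      where
      f : ℕ → ℕ
      f zero = 0
      f (suc n) = endpoint K (suc (p (f n)))
      f-< : ∀ n → f n < f (suc n)
      f-< n = ≤-trans (s≤s (p.n≤f (f n))) (Endpoint.n≤f K _)

    φ : Coded Y → Coded Z
    φ (I , y) = blocks I , enc y

    ψ : Coded Z → Coded Y
    ψ (K , z) = coarsen K , λ k → decode z k (dec _)

    -- The interval of `K` with index `n′ = p (endpoint L n)` starts at or after `n′`, so what is
    -- copied there comes from an interval of `I` starting at or after `endpoint L n`; decoding
    -- recovers `y` on it.
    φ≼⇒≼ψ : ∀ c d → φ c ≼ d → c ≼ ψ d
    φ≼⇒≼ψ (I , y) (K , z) (N , copy) = N ⊔ 1 , λ n N⊔1≤n →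
      let n′ = p (endpoint (coarsen K) n)
          n≤n′ = ≤-trans (Endpoint.n≤f (coarsen K) n) (p.n≤f _)
      in pull-back n (≤-trans (m⊔n≤o⇒n≤o N 1 N⊔1≤n) n≤n′)
           (copy n′ (≤-trans (m⊔n≤o⇒m≤o N 1 N⊔1≤n) n≤n′))
      where
      L = coarsen K
      pull-back : ∀ n → let n′ = p (endpoint L n) in 1 ≤ n′ →
        Copy (blocks I , enc y) (endpoint K n′) z (endpoint K (suc n′)) →
        Copy (I , y) (endpoint L n) (proj₂ (ψ (K , z))) (endpoint L (suc n))
      -- As `n′` is positive, the first interval of `blocks I`, which starts at 0, is not the copied
      -- one.
      pull-back n 1≤n′ (zero , a , _) = ⊥-elim (<⇒≱ 1≤n′ (≤-trans (Endpoint.n≤f K _) a))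
      pull-back n 1≤n′ (suc m , a , b , agree) = suc m ,
        p.cancel-≤ (≤-trans (Endpoint.n≤f K _) a) ,
        ≤-trans (p.n≤f _) b ,
        λ k (s , t) → decode-enc z k y
          (λ j u v → agree j (≤-trans (p.mono-≤ s) u , <-≤-trans v (p.mono-≤ t))) (dec _)

  -- A base of the meager ideal.

  Meets : Subset 2^ω → ℕ → 2^ω → ℕ → Set
  Meets N a w b = ∀ z → z ∈ N → ∃ λ k → a ≤ k × k < b × z k ≡ w k

  -- Induction on a: an extension that works for all z with z i = true is extended
  -- further to one that works for all z with z i = false.
  meets-extendable : ∀ {N} → NowhereDense N → ∀ a w b →
    ∃ λ w′ → ∃ λ b′ → b ≤ b′ × AgreeOn a b w′ w × Meets N a w′ b′
  meets-extendable {N} nd zero w b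
    -- The cylinder of the complement of `w` below `b` contains a `y` outside the closure of `N`.
    -- For some `L` no element of `N` agrees with `y` below `L`, so all of them meet the complement
    -- of `y`.
    with y , ¬y ← ¬∀⇒∃¬ (λ f → nd (not ∘ w) (b , f))
    with dec (AgreeBelow b (not ∘ w) y)
  ... | no ¬agree = ⊥-elim (¬y λ agree → ⊥-elim (¬agree agree))
  ... | yes agree with L , ¬L ← ¬∀⇒∃¬ (λ cl → ¬y λ _ → cl) =
    not ∘ y , b ⊔ L , m≤m⊔n b L ,
    (λ k _ k<b → trans (cong not (agree k k<b)) (not-involutive (w k))) ,
    λ z z∈N → meet z z∈N (dec _)
    where
    meet : ∀ z → z ∈ N → Dec (∃ λ k → 0 ≤ k × k < b ⊔ L × z k ≡ not (y k)) →
           ∃ λ k → 0 ≤ k × k < b ⊔ L × z k ≡ not (y k)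
    meet z z∈N (yes p) = p
    meet z z∈N (no ¬p) = ⊥-elim (¬L (z , (λ k k<L →
      trans (¬-not λ e → ¬p (k , z≤n , <-≤-trans k<L (m≤n⊔m b L) , e)) (not-involutive (y k))) , z∈N))
  meets-extendable {N} nd (suc i) w b
    -- The bound `b ⊔ suc i` lies beyond `i`, which protects the value written there.
    with w₁ , b₁ , b≤b₁ , agree₁ , meets₁ ← meets-extendable nd i (update i true w) (b ⊔ suc i)
    with w₂ , b₂ , b₁≤b₂ , agree₂ , meets₂ ← meets-extendable nd i (update i false w₁) b₁ =
    w₂ , b₂ , ≤-trans (≤-trans (m≤m⊔n b (suc i)) b≤b₁) b₁≤b₂ ,
    (λ k i<k k<b → trans (w₂≡w₁ i<k (<-≤-trans k<b (≤-trans (m≤m⊔n b (suc i)) b≤b₁)))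
      (trans (agree₁ k (<⇒≤ i<k) (<-≤-trans k<b (m≤m⊔n b (suc i)))) (update-> i true w i<k))) ,
    meets
    where
    w₂≡w₁ : ∀ {k} → i < k → k < b₁ → w₂ k ≡ w₁ k
    w₂≡w₁ {k} i<k k<b₁ = trans (agree₂ k (<⇒≤ i<k) k<b₁) (update-> i false w₁ i<k)

    w₁i : w₁ i ≡ true
    w₁i = trans (agree₁ i ≤-refl (m≤n⊔m b (suc i))) (update-≡ i true w)

    w₂i : w₂ i ≡ false
    w₂i = trans (agree₂ i ≤-refl (≤-trans (m≤n⊔m b (suc i)) b≤b₁)) (update-≡ i false w₁)

    meets : Meets N (suc i) w₂ b₂
    meets z z∈N with k , i≤k , k<b₂ , e ← meets₂ z z∈N with m≤n⇒m<n∨m≡n i≤k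
    ... | inj₁ i<k = k , i<k , k<b₂ , e
    -- Now `z i` is `false`, so `w₁`, being `true` at `i`, meets `z` strictly beyond `i`.
    ... | inj₂ refl with l , i≤l , l<b₁ , f ← meets₁ z z∈N with m≤n⇒m<n∨m≡n i≤l
    ...   | inj₁ i<l = l , i<l , <-≤-trans l<b₁ b₁≤b₂ , trans f (sym (w₂≡w₁ i<l l<b₁))
    ...   | inj₂ refl with () ← trans (sym w₂i) (trans (sym e) (trans f w₁i))

  𝓜-bound : ∀ {A} → A ∈ 𝓜 → ∃ λ c → A ⊆ Hits {λ _ → Bool} c
  𝓜-bound (N , nd , A⊆ , _) =
    let c , r = fusion {λ _ → Bool} (λ _ → true) (λ j → Meets (N j))
          (λ j → meets-extendable (nd j))
          (λ j a w b w′ b′ b≤b′ agree meets z z∈ →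
            let k , a≤k , k<b , e = meets z z∈
            in k , a≤k , <-≤-trans k<b b≤b′ , trans e (sym (agree k a≤k k<b)))
    in c , λ x∈A → let j , x∈N = A⊆ x∈A in j , λ n j≤n →
      let k , p , q , e = r j n j≤n _ x∈N in k , (p , q) , e

  -- Fixing the threshold gives countably many pieces. Each is nowhere dense, as every finite start
  -- can be continued by the complement of `y` through a whole interval.
  Hits∈𝓜 : ∀ c → Hits {λ _ → Bool} c ∈ 𝓜
  Hits∈𝓜 (I , y) = N , nowhereDense , ≐-refl {x = Hits (I , y)}
    where
    N : ℕ → Subset 2^ω
    N m x = ∀ n → m ≤ n → ∃[ k ] k ∈ interval I n × x k ≡ y k

    nowhereDense : ∀ m → NowhereDense (N m)
    nowhereDense m x (n , dense) =
      let v = splice n x (not ∘ y)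
          q = m ⊔ n
          w , agree , hit = dense v (λ k → splice-< n x (not ∘ y)) (endpoint I (suc q))
          k , (q≤k , k<) , e = hit q (m≤m⊔n m n)
          n≤k = ≤-trans (m≤n⊔m m n) (≤-trans (Endpoint.n≤f I q) q≤k)
      in not-¬ refl (trans (sym e) (trans (agree k k<) (splice-≥ n x (not ∘ y) n≤k)))

  -- Membership in `𝓜` asks for an exact union, so the pieces are cut down to `A`.
  𝓜-downwards : ∀ {A A′} → A ⊆ A′ → A′ ∈ 𝓜 → A ∈ 𝓜
  𝓜-downwards {A} sub (N , nd , p , q) =
    (λ n x → x ∈ N n × x ∈ A) ,
    (λ n x (l , f) → nd n x (l , λ y agree i →
      let z , b , z∈N , _ = f y agree i in z , b , z∈N)) ,
    (λ x∈A → let n , x∈N = p (sub x∈A) in n , x∈N , x∈A) , λ (n , _ , x∈A) → x∈A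

  𝓜-base : Base 𝓜
  𝓜-base = record
    { Code = Coded (λ _ → Bool)
    ; B = Hits
    ; B∈ = Hits∈𝓜
    ; bound = 𝓜-bound
    ; downwards = 𝓜-downwards
    }

  Bool-splits : Splits (λ _ → Bool)
  Bool-splits _ _ a = not a , λ e → not-¬ refl (sym e)

  -- The ideals `𝓗 F` and their Tukey maps to and from `𝓜`.

  module _ (F : IncreasingFunction) where

    FinF : ℕ → Set
    FinF = Fin ∘ fun F

    2≤F : ∀ k → 1 ≤ k → 2 ≤ fun F k
    2≤F (suc k) _ = ≤-trans (s≤s (positive F k)) (increasing F k)

    FinF-splits : Splits FinF
    FinF-splits k 1≤k = other (2≤F k 1≤k)
      where
      other : ∀ {n} → 2 ≤ n → (a : Fin n) → ∃ λ b → b ≢ a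
      other (s≤s (s≤s _)) zero = suc zero , λ ()
      other (s≤s (s≤s _)) (suc _) = zero , λ ()

    origin : Π F
    origin k = fromℕ< (positive F k)

    𝓗-bound : ∀ {A} → A ∈ 𝓗 F → ∃ λ c → A ⊆ Hits {FinF} c
    𝓗-bound (generator (I , y , p , _)) = (I , y) , p
    𝓗-bound empty = (singletons , origin) , ⊥-elim
    𝓗-bound (subset sub p) = let c , q = 𝓗-bound p in c , λ x∈ → q (sub x∈)
    𝓗-bound (union A p) =
      let d , le = ≼-directed (λ n → proj₁ (𝓗-bound (p n)))
      in d , λ (n , x∈) → ≼⇒⊆ (proj₁ (𝓗-bound (p n))) d (le n) (proj₂ (𝓗-bound (p n)) x∈)

    𝓗-base : Base (𝓗 F)
    𝓗-base = record
      { Code = Coded FinF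
      ; B = Hits
      ; B∈ = λ (I , y) → generator (I , y , ≐-refl {x = H F I y})
      ; bound = 𝓗-bound
      ; downwards = subset
      }

    bit : ∀ {n} → 2 ≤ n → Bool → Fin n
    bit (s≤s (s≤s _)) false = zero
    bit (s≤s (s≤s _)) true = suc zero

    bit-injective : ∀ {n} (p : 2 ≤ n) {b c} → bit p b ≡ bit p c → b ≡ c
    bit-injective (s≤s (s≤s _)) {false} {false} _ = refl
    bit-injective (s≤s (s≤s _)) {true} {true} _ = refl

    -- F 0 may be 1, so the coordinate 0 of Π F carries no information.
    shiftBits : 2^ω → Π F
    shiftBits y zero = origin zero
    shiftBits y (suc k) = bit (2≤F (suc k) (s≤s z≤n)) (y k)

    shiftBits-injective : ∀ y y′ k →
      AgreeOn {FinF} (suc k) (suc (suc k)) (shiftBits y) (shiftBits y′) → y k ≡ y′ k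
    shiftBits-injective y y′ k agree =
      bit-injective (2≤F (suc k) (s≤s z≤n)) (agree (suc k) ≤-refl ≤-refl)

    module Shift = BlockCoding {λ _ → Bool} {FinF} (λ _ → true) origin suc (λ _ → ≤-refl)
      shiftBits shiftBits-injective

    𝓜-𝓗 : Tukey 𝓜-base 𝓗-base
    𝓜-𝓗 = record
      { φ = φ
      ; ψ = ψ
      ; tukey = λ c d sub → ≼⇒⊆ c (ψ d) (φ≼⇒≼ψ c d (⊆⇒≼ FinF-splits (φ c) d (λ {x} → sub {x})))
      }
      where open Shift

    -- Each block has room for a one-hot code of a value below `fun F k`.
    blockStart : ℕ → ℕ
    blockStart zero = 0
    blockStart (suc k) = blockStart k + fun F k

    blockStart-< : ∀ k → blockStart k < blockStart (suc k)
    blockStart-< k = m<m+n (blockStart k) (positive F k)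

    blockPartition : IntervalPartition
    blockPartition = record
      { endpoint = blockStart ; endpoint-zero = refl ; endpoint-< = blockStart-< }

    oneHot : Π F → ℕ → ℕ → Bool
    oneHot y k j = (blockStart k + toℕ (y k)) ≡ᵇ j

    unary : Π F → 2^ω
    unary y j = oneHot y (proj₁ (locate blockPartition j)) j

    -- The true bit of `y` in block `k` is also true for `y′`, which determines `y′ k`.
    unary-injective : ∀ y y′ k →
      AgreeOn {λ _ → Bool} (blockStart k) (blockStart (suc k)) (unary y) (unary y′) → y k ≡ y′ k
    unary-injective y y′ k agree =
      toℕ-injective (+-cancelˡ-≡ (blockStart k) _ _ (sym (≡ᵇ⇒≡ _ j hot′)))
      where
      j = blockStart k + toℕ (y k)
      j≥ : blockStart k ≤ j
      j≥ = m≤m+n _ _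
      j< : j < blockStart (suc k)
      j< = +-monoʳ-< (blockStart k) (toℕ<n (y k))
      k≡ : proj₁ (locate blockPartition j) ≡ k
      k≡ = locate-unique blockPartition (j≥ , j<)
      hot′ : T (oneHot y′ k j)
      hot′ = subst (λ i → T (oneHot y′ i j)) k≡ (subst T (agree j j≥ j<)
        (subst (λ i → T (oneHot y i j)) (sym k≡) (≡⇒≡ᵇ j j refl)))

    module Unary = BlockCoding {FinF} {λ _ → Bool} origin (λ _ → true)
      blockStart blockStart-< unary unary-injective

    𝓗-𝓜 : Tukey 𝓗-base 𝓜-base
    𝓗-𝓜 = record
      { φ = φ
      ; ψ = ψ
      ; tukey = λ c d sub → ≼⇒⊆ c (ψ d) (φ≼⇒≼ψ c d (⊆⇒≼ Bool-splits (φ c) d (λ {x} → sub {x})))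
      }
      where open Unary

    add-𝓗 : ∃ (IsAdd (𝓗 F))
    add-𝓗 = IsAdd-exists 𝓗-base λ (d , b) →
      let c , ¬c = unbounded FinF-splits d in ¬c (λ {x} → b c {x})

    cof-𝓗 : ∃ (IsCof (𝓗 F))
    cof-𝓗 = IsCof-exists 𝓗-base

  add-𝓜 : ∃ (IsAdd 𝓜)
  add-𝓜 = IsAdd-exists 𝓜-base λ (d , b) →
    let c , ¬c = unbounded Bool-splits d in ¬c (λ {x} → b c {x})

  cof-𝓜 : ∃ (IsCof 𝓜)
  cof-𝓜 = IsCof-exists 𝓜-base

-- Any `F` can witness that the extrema are attained, since the invariants agree for all of them.
successor : IncreasingFunction
successor = record { fun = suc ; increasing = λ _ → ≤-refl ; positive = λ _ → s≤s z≤n }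

corollary3p20 : (∀ ℓ → ExcludedMiddle ℓ) →
    (∀ a b → Extensionality a b) →
    (Σ[ κ ∈ Set ] Σ[ μ ∈ (IncreasingFunction → Set) ]
    IsAdd 𝓜 κ × (∀ F → IsAdd (𝓗 F) (μ F)) × IsMin μ κ)
    ×
    (Σ[ κ ∈ Set ] Σ[ μ ∈ (IncreasingFunction → Set) ]
    IsCof 𝓜 κ × (∀ F → IsCof (𝓗 F) (μ F)) × IsMax μ κ)
corollary3p20 em ext =
  let open Classical em ext
      κ , add-κ = add-𝓜
      ν , cof-ν = cof-𝓜
      κ↣ F = Tukey.add-↣ (𝓗-𝓜 F) (proj₂ (add-𝓗 F)) add-κ
      ↣κ F = Tukey.add-↣ (𝓜-𝓗 F) add-κ (proj₂ (add-𝓗 F))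
      ν↣ F = Tukey.cof-↣ (𝓜-𝓗 F) cof-ν (proj₂ (cof-𝓗 F))
      ↣ν F = Tukey.cof-↣ (𝓗-𝓜 F) (proj₂ (cof-𝓗 F)) cof-ν
  in ( κ , proj₁ ∘ add-𝓗 , add-κ , proj₂ ∘ add-𝓗
     , (successor , CantorBernstein.bijection (κ↣ successor) (↣κ successor)) , κ↣ )
   , ( ν , proj₁ ∘ cof-𝓗 , cof-ν , proj₂ ∘ cof-𝓗
     , (successor , CantorBernstein.bijection (ν↣ successor) (↣ν successor)) , ↣ν )
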